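{- Consider the mesh patterns $$m_1=(12,\{(1,0),(1,1),(1,2),(2,0),(2,1)\}),\qquad m_2=(21,\{(0,1),(1,0),(1,1),(1,2),(2,1)\}).$$ Then $|\mathrm{Av}_n(\{231,m_1\})|=|\mathrm{Av}_n(\{231,m_2\})|$ for all $n\ge0$, and the common generating function $P(x)=\sum_{n\ge0}|\mathrm{Av}_n(\{231,m_i\})|x^n$ satisfies $$P(x)=xP(x)^2-x(P(x)-1)+1.$$ Its coefficients $1,1,1,2,4,9,21,51,\dots$ are an offset of the Motzkin numbers: for $n\ge1$ the coefficient of $x^n$ is the Motzkin number $M_{n-1}$ (where $M_0=1,M_1=1,M_2=2,M_3=4,\dots$).
   Context: Write $[n]=\{1,\dots,n\}$. A permutation of length $n$ is a bijection of $[n]$, written in one-line notation; $G(\pi)=\{(i,\pi(i)) : i\in[n]\}$ is its plot. A mesh pattern of length $k$ is a pair $p=(\tau,R)$ with $\tau$ a permutation of length $k$ and $R\subseteq\{0,\dots,k\}^2$. An occurrence of $p$ in a permutation $\pi$ of length $n$ is a subset $\omega\subseteq G(\pi)$ for which there are order-preserving injections $\alpha,\beta:[k]\to[n]$ such that (i) $\omega=\{(\alpha(i),\beta(j)):(i,j)\in G(\tau)\}$, and (ii) with $\alpha(0)=\beta(0)=0$, $\alpha(k+1)=\beta(k+1)=n+1$ and $R_{ij}=[\alpha(i)+1,\alpha(i+1)-1]\times[\beta(j)+1,\beta(j+1)-1]$, one has $R_{ij}\cap G(\pi)=\emptyset$ for every $(i,j)\in R$. A permutation avoids $p$ if it has no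 occurrence of $p$. A classical pattern $\pi$ is identified with the mesh pattern $(\pi,\emptyset)$. $\mathrm{Av}_n(S)$ is the set of all permutations of length $n$ (including the empty permutation for $n=0$) avoiding every pattern in $S$. -}

module Defs where

open import Algebra.Properties.Semiring.Sum using (sum)
open import Data.Fin.Base as Fin using (Fin; zero; suc; toℕ; fromℕ; inject₁)
open import Data.Fin.Patterns using (0F; 1F; 2F)
open import Data.Fin.Permutation as Perm using (Permutation′; permutation; _⟨$⟩ʳ_)
open import Data.Fin.Properties using (all?; _≟_)
open import Data.Integer.Base as ℤ using (ℤ)
import Data.Integer.Properties as ℤ
open import Data.List.Base using (List; []; _∷_)
open import Data.List.Membership.Propositional using (_∈_)
open import Data.List.Relation.Unary.All using (All)
open import Data.Nat.Base using (ℕ; zero; suc; _+_; _∸_; _<_)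
open import Data.Product.Base using (Σ; ∃₂; _×_; _,_; proj₁)
open import Data.Vec.Base using (Vec; []; _∷_; lookup)
import Data.Vec.Functional as Vector
open import Function.Base using (_∘_)
open import Function.Bundles using (Inverse)
open import Function.Definitions using (Injective)
open import Level using (0ℓ)
open import Relation.Binary.Bundles using (Setoid)
open import Relation.Binary.Definitions using (Monotonic₁)
open import Relation.Binary.PropositionalEquality
  using (_≡_; refl; sym; trans; setoid)
open import Relation.Nullary.Decidable using (True; toWitness)
open import Relation.Nullary.Negation using (¬_)
open import Relation.Unary using (Pred; _⊆_; _∩_; Empty)

------------------------------------------------------------------------
-- Permutations and mesh patterns
--
-- Positions and values of permutations are elements of Fin n, so the
-- element i of [n] is represented by the x : Fin n with toℕ x = i - 1.

plot : ∀ {n} → Permutation′ n → Pred (Fin n × Fin n) 0ℓ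
plot π (i , j) = π ⟨$⟩ʳ i ≡ j

-- The first vector is the one-line notation, the second one that of the
-- inverse permutation.
oneLine : ∀ {n} (v w : Vec (Fin n) n) →
          {True (all? λ i → lookup v (lookup w i) ≟ i)} →
          {True (all? λ i → lookup w (lookup v i) ≟ i)} →
          Permutation′ n
oneLine v w {p} {q} =
  permutation (lookup v) (lookup w) (toWitness p) (toWitness q)

-- The list `shaded` stands for the set of its members.
record MeshPattern : Set where
  constructor mesh
  field
    {size}     : ℕ
    underlying : Permutation′ size
    shaded     : List (Fin (suc size) × Fin (suc size))

classical : ∀ {k} → Permutation′ k → MeshPattern
classical τ = mesh τ []

-- The 1-based values α(0), α(1), …, α(k+1), where α(0) = 0 and
-- α(k+1) = n + 1.
extend : ∀ {k n} → (Fin k → Fin n) → Fin (suc (suc k)) → ℕ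
extend {k} {n} α =
  0 Vector.∷ Vector.insertAt (suc ∘ toℕ ∘ α) (fromℕ k) (suc n)

-- gap α i is the interval [α(i) + 1 , α(i+1) - 1].
gap : ∀ {k n} → (Fin k → Fin n) → Fin (suc k) → Pred (Fin n) 0ℓ
gap α i x = extend α (inject₁ i) < suc (toℕ x) × suc (toℕ x) < extend α (suc i)

box : ∀ {k n} (α β : Fin k → Fin n) → Fin (suc k) × Fin (suc k) →
      Pred (Fin n × Fin n) 0ℓ
box α β (i , j) (x , y) = gap α i x × gap β j y

record Occurrence (p : MeshPattern) {n : ℕ} (π : Permutation′ n) : Set where
  open MeshPattern p
  field
    α β         : Fin size → Fin n
    α-monotone  : Monotonic₁ Fin._≤_ Fin._≤_ α
    α-injective : Injective _≡_ _≡_ α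
    β-monotone  : Monotonic₁ Fin._≤_ Fin._≤_ β
    β-injective : Injective _≡_ _≡_ β

  ω : Pred (Fin n × Fin n) 0ℓ
  ω q = ∃₂ λ i j → plot underlying (i , j) × q ≡ (α i , β j)

  field
    ω⊆plot      : ω ⊆ plot π
    shadedEmpty : ∀ {ij} → ij ∈ shaded → Empty (box α β ij ∩ plot π)

Avoids : ∀ {n} → Permutation′ n → MeshPattern → Set
Avoids π p = ¬ Occurrence p π

-- Permutations are compared by their values, so that neither the proofs
-- of bijectivity nor those of avoidance contribute to the count.
Av : ℕ → List MeshPattern → Setoid 0ℓ 0ℓ
Av n S = record
  { Carrier       = Σ (Permutation′ n) λ π → All (Avoids π) S
  ; _≈_           = λ π ρ → proj₁ π Perm.≈ proj₁ ρ
  ; isEquivalence = record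
    { refl  = λ _ → refl
    ; sym   = λ eq i → sym (eq i)
    ; trans = λ eq₁ eq₂ i → trans (eq₁ i) (eq₂ i)
    }
  }

-- ∣ A ∣≡ k : the setoid A has exactly k elements up to its equality.
∣_∣≡_ : Setoid 0ℓ 0ℓ → ℕ → Set
∣ A ∣≡ k = Inverse A (setoid (Fin k))

τ₁₂ τ₂₁ : Permutation′ 2
τ₁₂ = oneLine (0F ∷ 1F ∷ []) (0F ∷ 1F ∷ [])
τ₂₁ = oneLine (1F ∷ 0F ∷ []) (1F ∷ 0F ∷ [])

τ₂₃₁ : Permutation′ 3
τ₂₃₁ = oneLine (1F ∷ 2F ∷ 0F ∷ []) (2F ∷ 0F ∷ 1F ∷ [])

m₁ m₂ : MeshPattern
m₁ = mesh τ₁₂ ((1F , 0F) ∷ (1F , 1F) ∷ (1F , 2F) ∷ (2F , 0F) ∷ (2F , 1F) ∷ [])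
m₂ = mesh τ₂₁ ((0F , 1F) ∷ (1F , 0F) ∷ (1F , 1F) ∷ (1F , 2F) ∷ (2F , 1F) ∷ [])

------------------------------------------------------------------------
-- Formal power series over ℤ, as coefficient sequences

PowerSeries : Set
PowerSeries = ℕ → ℤ

infixl 6 _⊕_ _⊖_
infixl 7 _⊛_

_⊕_ _⊖_ _⊛_ : PowerSeries → PowerSeries → PowerSeries
(f ⊕ g) n = f n ℤ.+ g n
(f ⊖ g) n = f n ℤ.- g n
(f ⊛ g) n = sum ℤ.+-*-semiring {suc n} λ i → f (toℕ i) ℤ.* g (n ∸ toℕ i)

𝟙 : PowerSeries
𝟙 zero    = ℤ.1ℤ
𝟙 (suc _) = ℤ.0ℤ

X : PowerSeries
X zero          = ℤ.0ℤ
X (suc zero)    = ℤ.1ℤ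
X (suc (suc _)) = ℤ.0ℤ

generatingFunction : (ℕ → ℕ) → PowerSeries
generatingFunction a n = ℤ.+ a n

------------------------------------------------------------------------
-- Motzkin numbers

-- The number of lattice paths with n steps, each up, level or down by
-- one, that start at height h, end at height 0 and never go below 0.
motzkinPaths : (n h : ℕ) → ℕ
motzkinPaths zero    zero    = 1
motzkinPaths zero    (suc h) = 0
motzkinPaths (suc n) zero    = motzkinPaths n 1 + motzkinPaths n 0
motzkinPaths (suc n) (suc h) =
  motzkinPaths n (suc (suc h)) + motzkinPaths n (suc h) + motzkinPaths n h

motzkin : ℕ → ℕ
motzkin n = motzkinPaths n 0

{-# OPTIONS --safe #-}

-- A 231-avoiding permutation is σ max τ with every value of σ below every
-- value of τ, so such permutations are binary trees.  An occurrence of m₁ is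
-- an ascent onto a right-to-left minimum; there is none iff no node has a
-- left but no right child.  An occurrence of m₂ is a descent by one between
-- neighbours; there is none iff no right child lacks a left child.  Both
-- kinds of nonempty trees correspond to unary-binary trees with as many
-- nodes, the second kind by a rotation.  Forests of unary-binary trees in
-- Polish notation satisfy the recurrence of the Motzkin paths, and by the
-- same recurrence the series of k-component forests is the k-th power of the
-- series N of trees, whence N = x (1 + N + N²) and P = 1 + N.
module Submission where

open import Defs
open import Algebra.Properties.Semiring.Sum using (sum-cong-≗; ∑-distrib-+)
open import Data.Empty using (⊥)
open import Data.Fin.Base as Fin using (Fin; toℕ; fromℕ<)
open import Data.Fin.Patterns using (0F; 1F; 2F)
open import Data.Fin.Permutation
  using (Permutation′; permutation; _⟨$⟩ʳ_; _⟨$⟩ˡ_; inverseʳ; inverseˡ)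
open import Data.Fin.Properties
  using (toℕ<n; toℕ-fromℕ<; toℕ-injective; fromℕ<-toℕ; injective⇒≤; 0↔⊥; 1↔⊤; +↔⊎)
import Data.Integer.Base as ℤ
import Data.Integer.Properties as ℤ
import Data.Integer.Tactic.RingSolver as ℤ-Solver
open import Data.List.Base using (List; []; _∷_; map; upTo)
open import Data.List.Membership.Propositional using (_∈_)
open import Data.List.Relation.Unary.All using ([]; _∷_)
open import Data.List.Relation.Unary.Any using (here; there)
open import Data.Nat.Base
open import Data.Nat.Properties
import Data.Nat.Tactic.RingSolver as ℕ-Solver
open import Data.Product.Base using (∃-syntax; _×_; _,_; proj₁; proj₂; uncurry)
open import Data.Sum.Base as Sum using (_⊎_; inj₁; inj₂)
open import Data.Sum.Function.Propositional using (_⊎-↔_)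
open import Data.Sum.Properties using (inj₁-injective; inj₂-injective)
open import Data.Unit.Base using (⊤; tt)
open import Data.Vec.Base as Vec using (Vec; lookup; []; _∷_)
open import Data.Vec.Relation.Unary.All using (All; []; _∷_)
open import Function.Base using (_∘_)
open import Function.Bundles using (_↔_; Inverse; Injection)
open import Function.Construct.Composition using (_↔-∘_)
open import Function.Definitions using (Injective)
open import Function.Properties.Inverse using (↔⇒↣)
open import Relation.Binary.Bundles using (Setoid)
open import Relation.Binary.Definitions using (tri<; tri≈; tri>; Monotonic₁)
open import Relation.Binary.PropositionalEquality
open import Relation.Nullary.Decidable.Core using (yes; no)
open import Relation.Nullary.Negation using (contradiction)

-- Forest numbers and power series

-- Counts the forests of unary-binary trees with given numbers of nodes and components. Removing the
-- root of the first tree leaves one component more, as many, or one fewer, according to its arity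
-- two, one or zero.
forests : ℕ → ℕ → ℕ
forests zero    zero    = 1
forests zero    (suc k) = 0
forests (suc m) zero    = 0
forests (suc m) (suc k) =
  forests m (suc (suc k)) + forests m (suc k) + forests m k

-- The height is the number of components minus one: each removed root is an up, level or down step.
-- The components run out exactly at the last node, which therefore contributes no step.
forests≡motzkinPaths : ∀ m k → forests (suc m) (suc k) ≡ motzkinPaths m k
forests≡motzkinPaths zero    zero    = refl
forests≡motzkinPaths zero    (suc k) = refl
forests≡motzkinPaths (suc m) zero    = trans (+-identityʳ _)
  (cong₂ _+_ (forests≡motzkinPaths m 1) (forests≡motzkinPaths m 0))
forests≡motzkinPaths (suc m) (suc k) =
  cong₂ _+_ (cong₂ _+_ (forests≡motzkinPaths m (suc (suc k)))
                       (forests≡motzkinPaths m (suc k)))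
            (forests≡motzkinPaths m k)

⊛-congʳ : ∀ {f f′} g → f ≗ f′ → f ⊛ g ≗ f′ ⊛ g
⊛-congʳ g f≗f′ n =
  sum-cong-≗ ℤ.+-*-semiring {suc n} λ i → cong (ℤ._* g (n ∸ toℕ i)) (f≗f′ (toℕ i))

⊛-distribˡ-⊕ : ∀ f g h → f ⊛ (g ⊕ h) ≗ f ⊛ g ⊕ f ⊛ h
⊛-distribˡ-⊕ f g h n = trans
  (sum-cong-≗ ℤ.+-*-semiring {suc n} λ i →
     ℤ.*-distribˡ-+ (f (toℕ i)) (g (n ∸ toℕ i)) (h (n ∸ toℕ i)))
  (∑-distrib-+ ℤ.+-*-semiring {suc n}
     (λ i → f (toℕ i) ℤ.* g (n ∸ toℕ i)) (λ i → f (toℕ i) ℤ.* h (n ∸ toℕ i)))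

⊛-distribʳ-⊕ : ∀ h f g → (f ⊕ g) ⊛ h ≗ f ⊛ h ⊕ g ⊛ h
⊛-distribʳ-⊕ h f g n = trans
  (sum-cong-≗ ℤ.+-*-semiring {suc n} λ i →
     ℤ.*-distribʳ-+ (h (n ∸ toℕ i)) (f (toℕ i)) (g (toℕ i)))
  (∑-distrib-+ ℤ.+-*-semiring {suc n}
     (λ i → f (toℕ i) ℤ.* h (n ∸ toℕ i)) (λ i → g (toℕ i) ℤ.* h (n ∸ toℕ i)))

𝟘-zeroˡ : ∀ g → (λ _ → ℤ.0ℤ) ⊛ g ≗ λ _ → ℤ.0ℤ
𝟘-zeroˡ g zero    = refl
𝟘-zeroˡ g (suc n) = trans (ℤ.+-identityˡ _) (𝟘-zeroˡ g n)

⊛-identityˡ : ∀ g → 𝟙 ⊛ g ≗ g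
⊛-identityˡ g zero    = trans (ℤ.+-identityʳ _) (ℤ.*-identityˡ (g 0))
⊛-identityˡ g (suc n) = trans
  (cong₂ ℤ._+_ (ℤ.*-identityˡ (g (suc n))) (𝟘-zeroˡ g n)) (ℤ.+-identityʳ _)

X⊛-suc : ∀ g n → (X ⊛ g) (suc n) ≡ g n
X⊛-suc g n = trans (ℤ.+-identityˡ _)
  (trans (⊛-congʳ g X∘suc≗𝟙 n) (⊛-identityˡ g n))
  where
  X∘suc≗𝟙 : X ∘ suc ≗ 𝟙
  X∘suc≗𝟙 zero    = refl
  X∘suc≗𝟙 (suc n) = refl

Φ : ℕ → PowerSeries
Φ k = generatingFunction λ m → forests m k

Φ-0 : Φ 0 ≗ 𝟙
Φ-0 zero    = refl
Φ-0 (suc n) = refl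

-- Hence `Φ k` is the k-th power of `Φ 1`. Induction on the coefficient, for all `j` at once, since
-- the recurrence raises `j` while lowering the coefficient.
Φ-⊛ : ∀ j k → Φ j ⊛ Φ k ≗ Φ (j + k)
Φ-⊛ zero    k n       = trans (⊛-congʳ (Φ k) Φ-0 n) (⊛-identityˡ (Φ k) n)
Φ-⊛ (suc j) k zero    = refl
Φ-⊛ (suc j) k (suc n) = begin
  (Φ (suc j) ⊛ Φ k) (suc n)
    -- `Φ (suc j)` has constant term 0, so what remains is the convolution with its shift, which is
    -- a sum of three series by the recurrence of `forests`.
    ≡⟨ ℤ.+-identityˡ _ ⟩
  ((Φ (suc (suc j)) ⊕ Φ (suc j) ⊕ Φ j) ⊛ Φ k) n
    ≡⟨ ⊛-distribʳ-⊕ (Φ k) (Φ (suc (suc j)) ⊕ Φ (suc j)) (Φ j) n ⟩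
  ((Φ (suc (suc j)) ⊕ Φ (suc j)) ⊛ Φ k ⊕ Φ j ⊛ Φ k) n
    ≡⟨ cong (ℤ._+ (Φ j ⊛ Φ k) n)
         (⊛-distribʳ-⊕ (Φ k) (Φ (suc (suc j))) (Φ (suc j)) n) ⟩
  (Φ (suc (suc j)) ⊛ Φ k ⊕ Φ (suc j) ⊛ Φ k ⊕ Φ j ⊛ Φ k) n
    ≡⟨ cong₂ ℤ._+_ (cong₂ ℤ._+_ (Φ-⊛ (suc (suc j)) k n) (Φ-⊛ (suc j) k n))
                   (Φ-⊛ j k n) ⟩
  Φ (suc j + k) (suc n) ∎
  where open ≡-Reasoning

-- The coefficients of 1 + N: the first summand is 1 for the empty tree at `n = 0` and vanishes
-- otherwise.
a : ℕ → ℕ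
a n = forests n 0 + forests n 1

-- With P = 1 + N one has P² - (P - 1) = 1 + N + N², and N = x (1 + N + N²) is the recurrence of
-- `forests`.
a-functionalEquation : let P = generatingFunction a in
  P ≗ (X ⊛ (P ⊛ P) ⊖ X ⊛ (P ⊖ 𝟙)) ⊕ 𝟙
a-functionalEquation zero    = refl
a-functionalEquation (suc n) = begin
  Φ 2 n ℤ.+ Φ 1 n ℤ.+ Φ 0 n
    ≡⟨ rearrange (Φ 0 n) (Φ 1 n) (Φ 2 n) ⟩
  (Φ 0 n ℤ.+ Φ 1 n ℤ.+ (Φ 1 n ℤ.+ Φ 2 n))
    ℤ.- (Φ 0 n ℤ.+ Φ 1 n ℤ.- Φ 0 n) ℤ.+ ℤ.0ℤ
    ≡⟨ cong₂ (λ x y → x ℤ.- y ℤ.+ ℤ.0ℤ) (sym P²) (cong (λ z → P n ℤ.- z) (Φ-0 n)) ⟩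
  (P ⊛ P) n ℤ.- (P ⊖ 𝟙) n ℤ.+ ℤ.0ℤ
    ≡⟨ cong₂ (λ x y → x ℤ.- y ℤ.+ ℤ.0ℤ) (sym (X⊛-suc (P ⊛ P) n))
                                        (sym (X⊛-suc (P ⊖ 𝟙) n)) ⟩
  ((X ⊛ (P ⊛ P) ⊖ X ⊛ (P ⊖ 𝟙)) ⊕ 𝟙) (suc n) ∎
  where
  open ≡-Reasoning
  P = generatingFunction a
  rearrange : ∀ x y z →
    z ℤ.+ y ℤ.+ x ≡ (x ℤ.+ y ℤ.+ (y ℤ.+ z)) ℤ.- (x ℤ.+ y ℤ.- x) ℤ.+ ℤ.0ℤ
  rearrange = ℤ-Solver.solve-∀
  Φ⊛P : ∀ k → (Φ k ⊛ P) n ≡ Φ (k + 0) n ℤ.+ Φ (k + 1) n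
  Φ⊛P k = trans (⊛-distribˡ-⊕ (Φ k) (Φ 0) (Φ 1) n)
    (cong₂ ℤ._+_ (Φ-⊛ k 0 n) (Φ-⊛ k 1 n))
  P² : (P ⊛ P) n ≡ Φ 0 n ℤ.+ Φ 1 n ℤ.+ (Φ 1 n ℤ.+ Φ 2 n)
  P² = trans (⊛-distribʳ-⊕ P (Φ 0) (Φ 1) n) (cong₂ ℤ._+_ (Φ⊛P 0) (Φ⊛P 1))

-- Motzkin trees among the binary trees

data Tree : Set where
  leaf : Tree
  node : Tree → Tree → Tree

size : Tree → ℕ
size leaf       = 0
size (node l r) = suc (size l + size r)

Hereditarily : (Tree → Tree → Set) → Tree → Set
Hereditarily C leaf       = ⊤
Hereditarily C (node l r) = C l r × Hereditarily C l × Hereditarily C r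

Node : Set
Node = Tree × Tree

toTree : Node → Tree
toTree = uncurry node

toTree-injective : Injective _≡_ _≡_ toTree
toTree-injective refl = refl

data Shape (A : Set) : Set where
  nullary : Shape A
  unary   : A → Shape A
  binary  : A → A → Shape A

-- The nonempty trees satisfying `C` at every node behave like unary-binary trees: each is built in
-- exactly one way from zero, one or two smaller ones, at the cost of one node. On trees that
-- violate `C` the value of `split` is arbitrary.
record MotzkinSpecification (C : Tree → Tree → Set) : Set where
  Good : Node → Set
  Good = Hereditarily C ∘ toTree

  field
    build         : Shape Node → Node
    split         : Node → Shape Node
    split-build   : ∀ x → split (build x) ≡ x
    build-split   : ∀ t → Good t → build (split t) ≡ t
    good-nullary  : Good (build nullary)
    good-unary    : ∀ t → Good t → Good (build (unary t))
    good-binary   : ∀ s t → Good s → Good t → Good (build (binary s t))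
    good-unary⁻¹  : ∀ t → Good (build (unary t)) → Good t
    good-binary⁻¹ : ∀ s t → Good (build (binary s t)) → Good s × Good t
    size-nullary  : size (toTree (build nullary)) ≡ 1
    size-unary    : ∀ t → size (toTree (build (unary t))) ≡ suc (size (toTree t))
    size-binary   : ∀ s t → size (toTree (build (binary s t))) ≡
                            suc (size (toTree s) + size (toTree t))

-- The unary-binary forests with m nodes and k components, in Polish notation.
Forest : ℕ → ℕ → Set
Forest zero    zero    = ⊤
Forest zero    (suc k) = ⊥
Forest (suc m) zero    = ⊥
Forest (suc m) (suc k) =
  (Forest m (suc (suc k)) ⊎ Forest m (suc k)) ⊎ Forest m k

Fin↔Forest : ∀ m k → Fin (forests m k) ↔ Forest m k
Fin↔Forest zero    zero    = 1↔⊤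
Fin↔Forest zero    (suc k) = 0↔⊥
Fin↔Forest (suc m) zero    = 0↔⊥
Fin↔Forest (suc m) (suc k) =
  (((Fin↔Forest m (suc (suc k)) ⊎-↔ Fin↔Forest m (suc k)) ↔-∘ +↔⊎)
    ⊎-↔ Fin↔Forest m k)
  ↔-∘ +↔⊎

Code : ℕ → Set
Code n = Forest n 0 ⊎ Forest n 1

Fin↔Code : ∀ n → Fin (a n) ↔ Code n
Fin↔Code n = (Fin↔Forest n 0 ⊎-↔ Fin↔Forest n 1) ↔-∘ +↔⊎

totalSize : ∀ {k} → Vec Node k → ℕ
totalSize []       = 0
totalSize (t ∷ ts) = size (toTree t) + totalSize ts

-- Polish notation and the trees it denotes

module Decoding {C : Tree → Tree → Set} (spec : MotzkinSpecification C) where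
  open MotzkinSpecification spec

  -- What a stack of `suc k` trees becomes when the root of its first tree is taken off, in the
  -- order of the summands of `Forest (suc m) (suc k)`.
  Operands : ℕ → Set
  Operands k = (Vec Node (suc (suc k)) ⊎ Vec Node (suc k)) ⊎ Vec Node k

  apply : ∀ {k} → Operands k → Vec Node (suc k)
  apply (inj₁ (inj₁ (s ∷ t ∷ ts))) = build (binary s t) ∷ ts
  apply (inj₁ (inj₂ (t ∷ ts)))     = build (unary t) ∷ ts
  apply (inj₂ ts)                  = build nullary ∷ ts

  unapply′ : ∀ {k} → Shape Node → Vec Node k → Operands k
  unapply′ nullary      ts = inj₂ ts
  unapply′ (unary t)    ts = inj₁ (inj₂ (t ∷ ts))
  unapply′ (binary s t) ts = inj₁ (inj₁ (s ∷ t ∷ ts))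

  unapply : ∀ {k} → Vec Node (suc k) → Operands k
  unapply (t ∷ ts) = unapply′ (split t) ts

  unapply-apply : ∀ {k} (x : Operands k) → unapply (apply x) ≡ x
  unapply-apply (inj₁ (inj₁ (s ∷ t ∷ ts))) = cong (λ x → unapply′ x ts) (split-build _)
  unapply-apply (inj₁ (inj₂ (t ∷ ts)))     = cong (λ x → unapply′ x ts) (split-build _)
  unapply-apply (inj₂ ts)                  = cong (λ x → unapply′ x ts) (split-build _)

  decode : ∀ m k → Forest m k → Vec Node k
  operands : ∀ m k → Forest (suc m) (suc k) → Operands k

  decode zero    zero    _ = []
  decode (suc m) (suc k) x = apply (operands m k x)

  operands m k = Sum.map (Sum.map (decode m (suc (suc k))) (decode m (suc k))) (decode m k)

  -- `unapply` recovers the first symbol and its operands from the stack, and induction recovers the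
  -- rest.
  decode-injective : ∀ m k → Injective _≡_ _≡_ (decode m k)
  operands-injective : ∀ m k → Injective _≡_ _≡_ (operands m k)

  decode-injective zero    zero    _  = refl
  decode-injective (suc m) (suc k) eq = operands-injective m k
    (trans (sym (unapply-apply _)) (trans (cong unapply eq) (unapply-apply _)))

  operands-injective m k {inj₁ (inj₁ _)} {inj₁ (inj₁ _)} eq =
    cong (inj₁ ∘ inj₁) (decode-injective m (suc (suc k)) (inj₁-injective (inj₁-injective eq)))
  operands-injective m k {inj₁ (inj₂ _)} {inj₁ (inj₂ _)} eq =
    cong (inj₁ ∘ inj₂) (decode-injective m (suc k) (inj₂-injective (inj₁-injective eq)))
  operands-injective m k {inj₂ _}        {inj₂ _}        eq =
    cong inj₂ (decode-injective m k (inj₂-injective eq))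
  operands-injective m k {inj₁ (inj₁ _)} {inj₁ (inj₂ _)} ()
  operands-injective m k {inj₁ (inj₂ _)} {inj₁ (inj₁ _)} ()
  operands-injective m k {inj₁ (inj₁ _)} {inj₂ _}        ()
  operands-injective m k {inj₁ (inj₂ _)} {inj₂ _}        ()
  operands-injective m k {inj₂ _}        {inj₁ (inj₁ _)} ()
  operands-injective m k {inj₂ _}        {inj₁ (inj₂ _)} ()

  decode-good : ∀ m k x → All Good (decode m k x)
  decode-good zero    zero    _               = []
  decode-good (suc m) (suc k) (inj₁ (inj₁ x))
    with s ∷ t ∷ ts ← decode m (suc (suc k)) x | p ∷ q ∷ ps ← decode-good m (suc (suc k)) x
    = good-binary s t p q ∷ ps
  decode-good (suc m) (suc k) (inj₁ (inj₂ x))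
    with t ∷ ts ← decode m (suc k) x | p ∷ ps ← decode-good m (suc k) x
    = good-unary t p ∷ ps
  decode-good (suc m) (suc k) (inj₂ x)        = good-nullary ∷ decode-good m k x

  totalSize-decode : ∀ m k x → totalSize (decode m k x) ≡ m
  totalSize-decode zero    zero    _               = refl
  totalSize-decode (suc m) (suc k) (inj₁ (inj₁ x))
    with s ∷ t ∷ ts ← decode m (suc (suc k)) x | eq ← totalSize-decode m (suc (suc k)) x
    = trans (cong (_+ totalSize ts) (size-binary s t))
            (cong suc (trans (+-assoc (size (toTree s)) _ _) eq))
  totalSize-decode (suc m) (suc k) (inj₁ (inj₂ x))
    with t ∷ ts ← decode m (suc k) x | eq ← totalSize-decode m (suc k) x
    = trans (cong (_+ totalSize ts) (size-unary t)) (cong suc eq)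
  totalSize-decode (suc m) (suc k) (inj₂ x)        =
    cong₂ _+_ size-nullary (totalSize-decode m k x)

  -- Splitting the first tree and returning its parts to the stack lowers the total size by one, so
  -- that the induction hypothesis encodes the new stack.
  decode-surjective : ∀ m {k} (ts : Vec Node k) → All Good ts → totalSize ts ≡ m →
                      ∃[ x ] decode m k x ≡ ts
  decode-surjective zero    []       _        _  = tt , refl
  decode-surjective zero    (t ∷ ts) _        ()
  decode-surjective (suc m) []       _        ()
  decode-surjective (suc m) (t ∷ ts) (p ∷ ps) eq with split t | build-split t p
  ... | nullary    | refl =
    let x , eq′ = decode-surjective m ts ps
          (suc-injective (trans (cong (_+ totalSize ts) (sym size-nullary)) eq))
    in inj₂ x , cong (apply ∘ inj₂) eq′
  ... | unary t′   | refl =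
    let x , eq′ = decode-surjective m (t′ ∷ ts) (good-unary⁻¹ t′ p ∷ ps)
          (suc-injective (trans (cong (_+ totalSize ts) (sym (size-unary t′))) eq))
    in inj₁ (inj₂ x) , cong (apply ∘ inj₁ ∘ inj₂) eq′
  ... | binary s t′ | refl =
    let q , q′  = good-binary⁻¹ s t′ p
        x , eq′ = decode-surjective m (s ∷ t′ ∷ ts) (q ∷ q′ ∷ ps) (suc-injective
          (trans (cong suc (sym (+-assoc (size (toTree s)) _ _)))
          (trans (cong (_+ totalSize ts) (sym (size-binary s t′))) eq)))
    in inj₁ (inj₁ x) , cong (apply ∘ inj₁ ∘ inj₁) eq′

  tree : ∀ n → Code n → Tree
  tree n (inj₁ _) = leaf
  tree n (inj₂ x) = toTree (Vec.head (decode n 1 x))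

  -- For each `n` only one summand of `Code n` is inhabited: a forest has no nodes exactly when it
  -- has no components.
  tree-injective : ∀ n → Injective _≡_ _≡_ (tree n)
  tree-injective zero {inj₁ _} {inj₁ _} eq = refl
  tree-injective (suc n) {inj₂ x} {inj₂ y} eq =
    cong inj₂ (decode-injective (suc n) 1
      (η (decode (suc n) 1 x) (decode (suc n) 1 y) (toTree-injective eq)))
    where
    η : (ts us : Vec Node 1) → Vec.head ts ≡ Vec.head us → ts ≡ us
    η (_ ∷ []) (_ ∷ []) refl = refl

  size-tree : ∀ n x → size (tree n x) ≡ n
  size-tree zero    (inj₁ _) = refl
  size-tree (suc n) (inj₂ x)
    with t ∷ [] ← decode (suc n) 1 x | eq ← totalSize-decode (suc n) 1 x
    = trans (sym (+-identityʳ _)) eq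

  tree-good : ∀ n x → Hereditarily C (tree n x)
  tree-good zero    (inj₁ _) = tt
  tree-good (suc n) (inj₂ x)
    with t ∷ [] ← decode (suc n) 1 x | p ∷ [] ← decode-good (suc n) 1 x
    = p

  tree-surjective : ∀ n t → Hereditarily C t → size t ≡ n → ∃[ x ] tree n x ≡ t
  tree-surjective n leaf       _ refl = inj₁ tt , refl
  tree-surjective n (node l r) p refl =
    let x , eq = decode-surjective n ((l , r) ∷ []) (p ∷ []) (+-identityʳ _)
    in inj₂ x , cong (toTree ∘ Vec.head) eq

-- The ascent into the maximum of σ max τ is forbidden exactly when τ is empty.
C₁ : Tree → Tree → Set
C₁ (node _ _) leaf = ⊥
C₁ _          _    = ⊤

-- A root without left child draws its maximum first. In the role of τ in σ max τ, such a tree would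
-- put the second largest value right behind the largest.
NotMaxFirst : Tree → Set
NotMaxFirst (node leaf _) = ⊥
NotMaxFirst _             = ⊤

C₂ : Tree → Tree → Set
C₂ l r = NotMaxFirst r

-- `C₁` excludes the nodes with a left child only; the arity is then the number of children, and an
-- only child is a right one.
spec₁ : MotzkinSpecification C₁
spec₁ = record
  { build         = λ where
      nullary                    → leaf , leaf
      (unary (l , r))            → leaf , node l r
      (binary (l , r) (l′ , r′)) → node l r , node l′ r′
  ; split         = λ where
      (leaf     , leaf)       → nullary
      (leaf     , node l r)   → unary (l , r)
      (node l r , node l′ r′) → binary (l , r) (l′ , r′)
      (node _ _ , leaf)       → nullary  -- junk, not a good node
  ; split-build   = λ where
      nullary      → refl
      (unary _)    → refl
      (binary _ _) → refl
  ; build-split   = λ where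
      (leaf     , leaf)     _ → refl
      (leaf     , node _ _) _ → refl
      (node _ _ , node _ _) _ → refl
  ; good-nullary  = _
  ; good-unary    = λ _ p → _ , _ , p
  ; good-binary   = λ _ _ p q → _ , p , q
  ; good-unary⁻¹  = λ _ (_ , _ , p) → p
  ; good-binary⁻¹ = λ _ _ (_ , p , q) → p , q
  ; size-nullary  = refl
  ; size-unary    = λ _ → refl
  ; size-binary   = λ _ _ → refl
  }

-- In the binary case the first operand is inserted, by a rotation, as left child of a new node on
-- the right branch of the second. Being nonempty, it grants `C₂` at the root, while the condition
-- on `r′` passes from the old root to the new node.
spec₂ : MotzkinSpecification C₂
spec₂ = record
  { build         = λ where
      nullary                    → leaf , leaf
      (unary (l , r))            → node l r , leaf
      (binary (l , r) (l′ , r′)) → l′ , node (node l r) r′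
  ; split         = λ where
      (leaf     , leaf)         → nullary
      (node l r , leaf)         → unary (l , r)
      (l′ , node (node l r) r′) → binary (l , r) (l′ , r′)
      (_  , node leaf _)        → nullary  -- junk, not a good node
  ; split-build   = λ where
      nullary                   → refl
      (unary _)                 → refl
      (binary _ (leaf     , _)) → refl
      (binary _ (node _ _ , _)) → refl
  ; build-split   = λ where
      (leaf     , leaf)              _ → refl
      (node _ _ , leaf)              _ → refl
      (leaf     , node (node _ _) _) _ → refl
      (node _ _ , node (node _ _) _) _ → refl
      (leaf     , node leaf _) ()
      (node _ _ , node leaf _) ()
  ; good-nullary  = _
  ; good-unary    = λ _ p → _ , p , _
  ; good-binary   = λ _ _ p (c , q , q′) → _ , q , c , p , q′
  ; good-unary⁻¹  = λ _ (_ , p , _) → p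
  ; good-binary⁻¹ = λ _ _ (_ , q , c , p , q′) → p , c , q , q′
  ; size-nullary  = refl
  ; size-unary    = λ (l , r) → cong suc (+-identityʳ _)
  ; size-binary   = λ (l , r) (l′ , r′) →
      cong suc (+-swap (size l′) (suc (size l + size r)) (size r′))
  }
  where
  +-swap : ∀ x y z → x + suc (y + z) ≡ y + suc (x + z)
  +-swap = ℕ-Solver.solve-∀

-- Permutations drawn by binary trees

private variable
  f f′ : ℕ → ℕ
  t t′ : Tree
  i j n p q v w : ℕ

-- Draws f t p q v w: f maps the positions [p , q) onto the values [v , w)
-- and, by the decomposition σ max τ with σ < τ, t is the tree of its shape.
data Draws (f : ℕ → ℕ) : Tree → (p q v w : ℕ) → Set where
  leaf : Draws f leaf p p v v
  node : ∀ {l r m u} → Draws f l p m v u → f m ≡ w → Draws f r (suc m) q u w →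
         Draws f (node l r) p q v (suc w)

draws-positions : Draws f t p q v w → p + size t ≡ q
draws-positions leaf = +-identityʳ _
draws-positions {p = p} (node {l = l} {r = r} L _ R) = trans (+-suc p _)
  (trans (cong suc (sym (+-assoc p (size l) (size r))))
  (trans (cong (λ m → suc m + size r) (draws-positions L)) (draws-positions R)))

draws-values : Draws f t p q v w → v + size t ≡ w
draws-values leaf = +-identityʳ _
draws-values {v = v} (node {l = l} {r = r} L _ R) = trans (+-suc v _)
  (cong suc (trans (sym (+-assoc v (size l) (size r)))
  (trans (cong (_+ size r) (draws-values L)) (draws-values R))))

draws-p≤q : Draws f t p q v w → p ≤ q
draws-p≤q {p = p} D = subst (p ≤_) (draws-positions D) (m≤m+n p _)

draws-v≤w : Draws f t p q v w → v ≤ w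
draws-v≤w {v = v} D = subst (v ≤_) (draws-values D) (m≤m+n v _)

draws-cong : (∀ i → p ≤ i → i < q → f i ≡ f′ i) → Draws f t p q v w → Draws f′ t p q v w
draws-cong eq leaf         = leaf
draws-cong eq (node L fm R) =
  node (draws-cong (λ i p≤i i<m → eq i p≤i (<-≤-trans i<m (<⇒≤ m<q))) L)
       (trans (sym (eq _ p≤m m<q)) fm)
       (draws-cong (λ i m<i i<q → eq i (≤-trans p≤m (<⇒≤ m<i)) i<q) R)
  where
  p≤m = draws-p≤q L
  m<q = draws-p≤q R

-- The size of the left subtree fixes both the position of the maximum and the value separating the
-- two sides.
draws-unique : Draws f t p q v w → Draws f′ t p q v w → ∀ i → p ≤ i → i < q → f i ≡ f′ i
draws-unique leaf leaf i p≤i i<q = contradiction (<-≤-trans i<q p≤i) (<-irrefl refl)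
draws-unique (node {m = m} L fm R) (node L′ fm′ R′) i p≤i i<q
  with trans (sym (draws-positions L)) (draws-positions L′)
     | trans (sym (draws-values L)) (draws-values L′)
... | refl | refl with <-cmp i m
...   | tri< i<m _ _  = draws-unique L L′ i p≤i i<m
...   | tri≈ _ refl _ = trans fm (sym fm′)
...   | tri> _ _ m<i  = draws-unique R R′ i m<i i<q

draws-≥ : Draws f t p q v w → p ≤ i → i < q → v ≤ f i
draws-≥ leaf p≤i i<q = contradiction (<-≤-trans i<q p≤i) (<-irrefl refl)
draws-≥ {i = i} (node {m = m} L fm R) p≤i i<q with <-cmp i m
... | tri< i<m _ _  = draws-≥ L p≤i i<m
... | tri≈ _ refl _ = subst (_ ≤_) (sym fm) (≤-trans (draws-v≤w L) (draws-v≤w R))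
... | tri> _ _ m<i  = ≤-trans (draws-v≤w L) (draws-≥ R m<i i<q)

draws-< : Draws f t p q v w → p ≤ i → i < q → f i < w
draws-< leaf p≤i i<q = contradiction (<-≤-trans i<q p≤i) (<-irrefl refl)
draws-< {i = i} (node {m = m} L fm R) p≤i i<q with <-cmp i m
... | tri< i<m _ _  = ≤-trans (draws-< L p≤i i<m) (m≤n⇒m≤1+n (draws-v≤w R))
... | tri≈ _ refl _ = s≤s (≤-reflexive fm)
... | tri> _ _ m<i  = m≤n⇒m≤1+n (draws-< R m<i i<q)

draws-surjective : Draws f t p q v w → ∀ y → v ≤ y → y < w →
                   ∃[ i ] p ≤ i × i < q × f i ≡ y
draws-surjective leaf y v≤y y<w = contradiction (<-≤-trans y<w v≤y) (<-irrefl refl)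
draws-surjective (node {w = w} {u = u} L fm R) y v≤y y<w with y ≟ w
... | yes refl = _ , draws-p≤q L , draws-p≤q R , fm
... | no y≢w with y <? u
...   | yes y<u =
  let i , p≤i , i<m , eq = draws-surjective L y v≤y y<u
  in i , p≤i , <-trans i<m (draws-p≤q R) , eq
...   | no y≮u =
  let i , m<i , i<q , eq = draws-surjective R y (≮⇒≥ y≮u) (≤∧≢⇒< (s≤s⁻¹ y<w) y≢w)
  in i , ≤-trans (draws-p≤q L) (<⇒≤ m<i) , i<q , eq

draws-left<right : ∀ {l r m u} → Draws f l p m v u → Draws f r (suc m) q u w →
                   p ≤ i → i < m → m < j → j < q → f i < f j
draws-left<right L R p≤i i<m m<j j<q = <-≤-trans (draws-< L p≤i i<m) (draws-≥ R m<j j<q)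

draws-<max : ∀ {l r m u} → Draws f l p m v u → f m ≡ w → Draws f r (suc m) q u w →
             p ≤ i → i < q → i ≢ m → f i < f m
draws-<max {i = i} {m = m} L refl R p≤i i<q i≢m with <-cmp i m
... | tri< i<m _ _ = <-≤-trans (draws-< L p≤i i<m) (draws-v≤w R)
... | tri≈ _ i≡m _ = contradiction i≡m i≢m
... | tri> _ _ m<i = draws-< R m<i i<q

draws-injective : Draws f t p q v w → p ≤ i → i < q → p ≤ j → j < q → f i ≡ f j → i ≡ j
draws-injective leaf p≤i i<q _ _ _ = contradiction (<-≤-trans i<q p≤i) (<-irrefl refl)
draws-injective {i = i} {j = j} (node {m = m} L fm R) p≤i i<q p≤j j<q eq
  with <-cmp i m | <-cmp j m
... | tri≈ _ refl _ | tri≈ _ refl _ = refl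
... | tri≈ _ refl _ | tri< _ j≢m _  = contradiction (sym eq) (<⇒≢ (draws-<max L fm R p≤j j<q j≢m))
... | tri≈ _ refl _ | tri> _ j≢m _  = contradiction (sym eq) (<⇒≢ (draws-<max L fm R p≤j j<q j≢m))
... | tri< _ i≢m _  | tri≈ _ refl _ = contradiction eq (<⇒≢ (draws-<max L fm R p≤i i<q i≢m))
... | tri> _ i≢m _  | tri≈ _ refl _ = contradiction eq (<⇒≢ (draws-<max L fm R p≤i i<q i≢m))
... | tri< i<m _ _  | tri< j<m _ _  = draws-injective L p≤i i<m p≤j j<m eq
... | tri< i<m _ _  | tri> _ _ m<j  = contradiction eq (<⇒≢ (draws-left<right L R p≤i i<m m<j j<q))
... | tri> _ _ m<i  | tri< j<m _ _  = contradiction (sym eq) (<⇒≢ (draws-left<right L R p≤j j<m m<i i<q))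
... | tri> _ _ m<i  | tri> _ _ m<j  = draws-injective R m<i i<q m<j j<q eq

Avoids231 : (ℕ → ℕ) → (p q : ℕ) → Set
Avoids231 f p q = ∀ {i j k} → p ≤ i → i < j → j < k → k < q → f k < f i → f i < f j → ⊥

-- A 231 not confined to one side either begins left and ends right of the maximum, against σ < τ,
-- or uses the maximum as its first or last entry, which is not its largest.
draws-avoids231 : Draws f t p q v w → Avoids231 f p q
draws-avoids231 leaf p≤i i<j j<k k<p =
  contradiction (<-trans (<-trans (≤-<-trans p≤i i<j) j<k) k<p) (<-irrefl refl)
draws-avoids231 (node {m = m} L fm R) {i} {j} {k} p≤i i<j j<k k<q fk<fi fi<fj
  with <-cmp i m | <-cmp k m
... | tri< i<m _ _  | tri< k<m _ _  = draws-avoids231 L p≤i i<j j<k k<m fk<fi fi<fj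
... | tri< i<m _ _  | tri> _ _ m<k  = <-asym fk<fi (draws-left<right L R p≤i i<m m<k k<q)
... | tri> _ _ m<i  | _             = draws-avoids231 R m<i i<j j<k k<q fk<fi fi<fj
... | tri≈ _ refl _ | _             =
  <-asym fi<fj (draws-<max L fm R (≤-trans p≤i (<⇒≤ i<j)) (<-trans j<k k<q) (>⇒≢ i<j))
... | tri< i<m i≢m _ | tri≈ _ refl _ =
  <-asym fk<fi (draws-<max L fm R p≤i (<-trans (<-trans i<j j<k) k<q) i≢m)

-- The root lies at the only position of the largest value; this determines the size of the left
-- subtree and hence the separating value.
draws-tree-unique : Draws f t p q v w → Draws f t′ p q v w → t ≡ t′
draws-tree-unique leaf leaf = refl
draws-tree-unique leaf (node L _ R) =
  contradiction (≤-<-trans (draws-p≤q L) (draws-p≤q R)) (<-irrefl refl)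
draws-tree-unique (node L _ R) leaf =
  contradiction (≤-<-trans (draws-p≤q L) (draws-p≤q R)) (<-irrefl refl)
draws-tree-unique {f = f} {p = p} {v = v} D@(node {l = l} {m = m} L fm R) (node {l = l′} L′ fm′ R′)
  with draws-injective D (draws-p≤q L) (draws-p≤q R) (draws-p≤q L′) (draws-p≤q R′)
                         (trans fm (sym fm′))
... | refl
  with trans (sym (draws-values L)) (trans (cong (v +_) (+-cancelˡ-≡ p (size l) (size l′)
         (trans (draws-positions L) (sym (draws-positions L′))))) (draws-values L′))
... | refl = cong₂ node (draws-tree-unique L L′) (draws-tree-unique R R′)

-- From trees to drawings, and from 231-avoiding bijections to trees

glue : (m w : ℕ) (f g : ℕ → ℕ) → ℕ → ℕ
glue m w f g i with <-cmp i m
... | tri< _ _ _ = f i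
... | tri≈ _ _ _ = w
... | tri> _ _ _ = g i

glue-< : ∀ {m} w f g i → i < m → f i ≡ glue m w f g i
glue-< {m} w f g i i<m with <-cmp i m
... | tri< _ _ _   = refl
... | tri≈ i≮m _ _ = contradiction i<m i≮m
... | tri> i≮m _ _ = contradiction i<m i≮m

glue-≡ : ∀ m w f g → glue m w f g m ≡ w
glue-≡ m w f g with <-cmp m m
... | tri< _ m≢m _ = contradiction refl m≢m
... | tri≈ _ _ _   = refl
... | tri> _ m≢m _ = contradiction refl m≢m

glue-> : ∀ {m} w f g i → m < i → g i ≡ glue m w f g i
glue-> {m} w f g i m<i with <-cmp i m
... | tri< _ _ m≮i = contradiction m<i m≮i
... | tri≈ _ _ m≮i = contradiction m<i m≮i
... | tri> _ _ _   = refl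

drawing : ∀ t p v → ∃[ f ] Draws f t p (p + size t) v (v + size t)
-- The empty tree constrains no value; the identity is a default.
drawing leaf       p v rewrite +-identityʳ p | +-identityʳ v = (λ i → i) , leaf
drawing (node l r) p v
  rewrite +-suc p (size l + size r) | +-suc v (size l + size r)
        | sym (+-assoc p (size l) (size r)) | sym (+-assoc v (size l) (size r)) =
  let m = p + size l
      u = v + size l
      w = u + size r
      f , L = drawing l p v
      g , R = drawing r (suc m) u
  in glue m w f g ,
     node (draws-cong (λ i _ → glue-< w f g i) L) (glue-≡ m w f g)
          (draws-cong (λ i m<i _ → glue-> w f g i m<i) R)

-- The inequality q - p ≤ w - v between the lengths of two intervals, written without subtraction.
pigeonhole : Injective _≡_ _≡_ f → v ≤ w → (∀ i → p ≤ i → i < q → v ≤ f i × f i < w) →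
             q + v ≤ w + p
pigeonhole {f} {v} {w} {p} {q} f-inj v≤w f∈ = begin
  q + v           ≤⟨ +-monoˡ-≤ v (m≤n+m∸n q p) ⟩
  p + (q ∸ p) + v ≤⟨ +-monoˡ-≤ v (+-monoʳ-≤ p (injective⇒≤ {f = F} F-inj)) ⟩
  p + (w ∸ v) + v ≡⟨ +-assoc p _ v ⟩
  p + (w ∸ v + v) ≡⟨ cong (p +_) (m∸n+n≡m v≤w) ⟩
  p + w           ≡⟨ +-comm p w ⟩
  w + p           ∎
  where
  open ≤-Reasoning
  <q : ∀ (x : Fin (q ∸ p)) → p + toℕ x < q
  <q x = ≰⇒> λ q≤ → <⇒≱ (toℕ<n x) (m≤n+o⇒m∸n≤o q p q≤)
  F : Fin (q ∸ p) → Fin (w ∸ v)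
  F x = fromℕ< (∸-monoˡ-< (proj₂ (f∈ (p + toℕ x) (m≤m+n p _) (<q x)))
                          (proj₁ (f∈ (p + toℕ x) (m≤m+n p _) (<q x))))
  F-inj : Injective _≡_ _≡_ F
  F-inj {x} {y} eq = toℕ-injective (+-cancelˡ-≡ p _ _ (f-inj (∸-cancelʳ-≡
    (proj₁ (f∈ (p + toℕ x) (m≤m+n p _) (<q x)))
    (proj₁ (f∈ (p + toℕ y) (m≤m+n p _) (<q y)))
    (trans (sym (toℕ-fromℕ< _)) (trans (cong toℕ eq) (toℕ-fromℕ< _))))))

module _ {f g : ℕ → ℕ} (g∘f : ∀ i → g (f i) ≡ i) (f∘g : ∀ y → f (g y) ≡ y) where

  private
    f-injective : Injective _≡_ _≡_ f
    f-injective {i} {j} eq = trans (sym (g∘f i)) (trans (cong g eq) (g∘f j))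

  -- Induction on a bound `n` for the length of the interval. An entry left of the maximum exceeding
  -- one to its right would form a 231 with it; so the left values all lie below the right ones, and
  -- counting shows that each side fills an interval of values.
  avoids231-draws : ∀ n {p q v w} → q ≤ n + p → p ≤ q → p + w ≡ q + v →
    (∀ i → p ≤ i → i < q → v ≤ f i × f i < w) →
    (∀ y → v ≤ y → y < w → p ≤ g y × g y < q) →
    Avoids231 f p q → ∃[ t ] Draws f t p q v w
  avoids231-draws n {p} {q} {v} {w} q≤n+p p≤q eq f∈ g∈ av with p ≟ q
  avoids231-draws n {p} {q} {v} {w} q≤n+p p≤q eq f∈ g∈ av | yes refl
    with refl ← +-cancelˡ-≡ p w v eq = leaf , leaf
  avoids231-draws zero q≤p p≤q _ _ _ _ | no p≢q = contradiction (≤-antisym p≤q q≤p) p≢q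
  -- No values below 0 are available, whereas the equal lengths demand at least one.
  avoids231-draws (suc n) {p} {q} {v} {zero} _ p≤q eq _ _ _ | no p≢q =
    contradiction (≤-trans (m≤m+n q v) (≤-reflexive (trans (sym eq) (+-identityʳ p))))
                  (<⇒≱ (≤∧≢⇒< p≤q p≢q))
  avoids231-draws (suc n) {p} {q} {v} {suc w} q≤n+p p≤q eq f∈ g∈ av | no p≢q =
    let l , L = avoids231-draws n m≤n+p p≤m p+u≡m+v leftValues leftPositions
                  λ p≤i i<j j<k k<m → av p≤i i<j j<k (<-trans k<m m<q)
        r , R = avoids231-draws n q≤n+1+m m<q 1+m+w≡q+u rightValues rightPositions
                  λ m<i i<j j<k k<q → av (≤-trans p≤m (<⇒≤ m<i)) i<j j<k k<q
    in node l r , node L (f∘g w) R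
    where
    m = g w
    p<q = ≤∧≢⇒< p≤q p≢q
    v≤w : v ≤ w
    v≤w = +-cancelˡ-≤ p v w (s≤s⁻¹ (subst (p + v <_) (trans (sym eq) (+-suc p w)) (+-monoˡ-< v p<q)))
    p≤m = proj₁ (g∈ w v≤w (n<1+n w))
    m<q = proj₂ (g∈ w v≤w (n<1+n w))
    -- The values from `v` on are to be used up by the `m ∸ p` positions left of the maximum.
    u = v + (m ∸ p)
    p+u≡m+v : p + u ≡ m + v
    p+u≡m+v = trans (+-comm p u) (trans (+-assoc v (m ∸ p) p)
      (trans (cong (v +_) (m∸n+n≡m p≤m)) (+-comm v m)))
    1+m+w≡q+u : suc m + w ≡ q + u
    1+m+w≡q+u = +-cancelˡ-≡ p _ _ (begin
      p + (suc m + w)   ≡⟨ rearrange p m w ⟩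
      m + (p + suc w)   ≡⟨ cong (m +_) eq ⟩
      m + (q + v)       ≡⟨ +-swap m q v ⟩
      q + (m + v)       ≡⟨ cong (q +_) (sym p+u≡m+v) ⟩
      q + (p + u)       ≡⟨ +-swap q p u ⟩
      p + (q + u)       ∎)
      where
      open ≡-Reasoning
      rearrange : ∀ x y z → x + (suc y + z) ≡ y + (x + suc z)
      rearrange = ℕ-Solver.solve-∀
      +-swap : ∀ x y z → x + (y + z) ≡ y + (x + z)
      +-swap = ℕ-Solver.solve-∀
    m≤n+p : m ≤ n + p
    m≤n+p = s≤s⁻¹ (≤-trans m<q q≤n+p)
    q≤n+1+m : q ≤ n + suc m
    q≤n+1+m = ≤-trans q≤n+p (subst (_≤ n + suc m) (+-suc n p) (+-monoʳ-≤ n (s≤s p≤m)))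
    u≤w : u ≤ w
    u≤w = +-cancelˡ-≤ q u w (subst (_≤ q + w) 1+m+w≡q+u (+-monoˡ-≤ w m<q))
    f≢w : ∀ {i} → i ≢ m → f i ≢ w
    f≢w i≢m fi≡w = i≢m (trans (sym (g∘f _)) (cong g fi≡w))
    f<w : ∀ {i} → p ≤ i → i < q → i ≢ m → f i < w
    f<w p≤i i<q i≢m = ≤∧≢⇒< (s≤s⁻¹ (proj₂ (f∈ _ p≤i i<q))) (f≢w i≢m)
    left<right : ∀ {i j} → p ≤ i → i < m → m < j → j < q → f i < f j
    left<right {i} {j} p≤i i<m m<j j<q with <-cmp (f i) (f j)
    ... | tri< fi<fj _ _ = fi<fj
    ... | tri≈ _ fi≡fj _ = contradiction (f-injective fi≡fj) (<⇒≢ (<-trans i<m m<j))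
    ... | tri> _ _ fj<fi = contradiction
      (subst (f i <_) (sym (f∘g w)) (f<w p≤i (<-trans i<m m<q) (<⇒≢ i<m)))
      (av p≤i i<m m<j j<q fj<fi)
    leftValues : ∀ i → p ≤ i → i < m → v ≤ f i × f i < u
    -- All values right of the maximum fit strictly between `f i` and `w`, which pushes `f i` below
    -- `u`.
    leftValues i p≤i i<m = proj₁ (f∈ i p≤i (<-trans i<m m<q)) ,
      +-cancelˡ-≤ q (suc (f i)) u (≤-trans
        (pigeonhole f-injective (f<w p≤i (<-trans i<m m<q) (<⇒≢ i<m)) λ j m<j j<q →
          left<right p≤i i<m m<j j<q ,
          f<w (≤-trans p≤m (<⇒≤ m<j)) j<q (>⇒≢ m<j))
        (≤-reflexive (trans (+-comm w (suc m)) 1+m+w≡q+u)))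
    rightValues : ∀ i → m < i → i < q → u ≤ f i × f i < w
    rightValues i m<i i<q =
      -- Dually, all values left of the maximum fit between `v` and `f i`, the latter excluded.
      +-cancelˡ-≤ p u (f i) (≤-trans (≤-reflexive p+u≡m+v) (≤-trans
        (pigeonhole f-injective (proj₁ (f∈ i (≤-trans p≤m (<⇒≤ m<i)) i<q)) λ j p≤j j<m →
          proj₁ (f∈ j p≤j (<-trans j<m m<q)) , left<right p≤j j<m m<i i<q)
        (≤-reflexive (+-comm (f i) p)))) ,
      f<w (≤-trans p≤m (<⇒≤ m<i)) i<q (>⇒≢ m<i)
    leftPositions : ∀ y → v ≤ y → y < u → p ≤ g y × g y < m
    leftPositions y v≤y y<u with g∈ y v≤y (m≤n⇒m≤1+n (≤-trans y<u u≤w))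
    ... | p≤gy , gy<q with <-cmp (g y) m
    ...   | tri< gy<m _ _ = p≤gy , gy<m
    ...   | tri≈ _ gy≡m _ = contradiction
      (trans (sym (f∘g y)) (trans (cong f gy≡m) (f∘g w))) (<⇒≢ (<-≤-trans y<u u≤w))
    ...   | tri> _ _ m<gy = contradiction
      (subst (u ≤_) (f∘g y) (proj₁ (rightValues (g y) m<gy gy<q))) (<⇒≱ y<u)
    rightPositions : ∀ y → u ≤ y → y < w → m < g y × g y < q
    rightPositions y u≤y y<w with g∈ y (≤-trans (m≤m+n v _) u≤y) (m≤n⇒m≤1+n y<w)
    ... | p≤gy , gy<q with <-cmp (g y) m
    ...   | tri> _ _ m<gy = m<gy , gy<q
    ...   | tri≈ _ gy≡m _ = contradiction
      (trans (sym (f∘g y)) (trans (cong f gy≡m) (f∘g w))) (<⇒≢ y<w)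
    ...   | tri< gy<m _ _ = contradiction
      (subst (_< u) (f∘g y) (proj₂ (leftValues (g y) p≤gy gy<m))) (≤⇒≯ u≤y)

-- Mesh patterns in drawings

Avoids₁ : (ℕ → ℕ) → (p q : ℕ) → Set
Avoids₁ f p q = ∀ {i} → p ≤ i → suc i < q → f i < f (suc i) →
                (∀ {j} → suc i < j → j < q → f (suc i) < f j) → ⊥

Avoids₂ : (ℕ → ℕ) → (p q : ℕ) → Set
Avoids₂ f p q = ∀ {i} → p ≤ i → suc i < q → f i ≢ suc (f (suc i))

draws-avoids₁ : Draws f t p q v w → Hereditarily C₁ t → Avoids₁ f p q
draws-avoids₁ leaf _ {i} p≤i 1+i<p =
  contradiction (<-trans (s≤s p≤i) 1+i<p) (<-irrefl refl)
draws-avoids₁ (node {m = m} L fm R) (c , hl , hr) {i} p≤i 1+i<q fi<f1+i min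
  with <-cmp (suc i) m
... | tri< 1+i<m _ _  = draws-avoids₁ L hl p≤i 1+i<m fi<f1+i
                          λ 1+i<j j<m → min 1+i<j (<-trans j<m (draws-p≤q R))
-- The ascent ends in the maximum. As position `i` makes the left subtree nonempty, so is the right
-- one, and its first entry shows that the maximum is no right-to-left minimum.
... | tri≈ _ refl _   =
  let 1+m<q = right-nonempty c L (s≤s p≤i) R
  in <-asym (min (n<1+n _) 1+m<q)
            (draws-<max L fm R (m≤n⇒m≤1+n (m≤n⇒m≤1+n p≤i)) 1+m<q (>⇒≢ (n<1+n _)))
  where
  right-nonempty : ∀ {l r m u} → C₁ l r → Draws f l p m v u → p < m →
                   Draws f r (suc m) q u w → suc m < q
  right-nonempty {l = leaf} _ leaf p<p _               = contradiction p<p (<-irrefl refl)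
  right-nonempty {r = node _ _} _ _ _ (node L′ _ R′) = ≤-<-trans (draws-p≤q L′) (draws-p≤q R′)
... | tri> _ _ (s≤s m≤i) with m≤n⇒m<n∨m≡n m≤i
...   | inj₁ m<i  = draws-avoids₁ R hr m<i 1+i<q fi<f1+i min
...   | inj₂ refl =
  <-asym fi<f1+i (draws-<max L fm R (m≤n⇒m≤1+n p≤i) 1+i<q (>⇒≢ (n<1+n i)))

-- With a left but no right child the maximum comes last, and the ascent into it is forbidden. For
-- the left subtree, its right-to-left minima remain such in the whole interval, everything further
-- right being larger.
avoids₁-good : Draws f t p q v w → Avoids₁ f p q → Hereditarily C₁ t
avoids₁-good leaf _ = tt
avoids₁-good {f} {p = p} {q = q} {v = v} (node {m = m} L fm R) av =
  condition L R ,
  avoids₁-good L (λ {i} p≤i 1+i<m fi<f1+i min → av p≤i (<-trans 1+i<m m<q) fi<f1+i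
    λ {j} 1+i<j j<q → extend-min p≤i 1+i<m min 1+i<j j<q) ,
  avoids₁-good R (λ m<i → av (≤-trans p≤m (<⇒≤ m<i)))
  where
  p≤m = draws-p≤q L
  m<q = draws-p≤q R
  extend-min : ∀ {i} → p ≤ i → suc i < m → (∀ {j} → suc i < j → j < m → f (suc i) < f j) →
               ∀ {j} → suc i < j → j < q → f (suc i) < f j
  extend-min {i} p≤i 1+i<m min {j} 1+i<j j<q with <-cmp j m
  ... | tri< j<m _ _  = min 1+i<j j<m
  ... | tri≈ _ refl _ =
    draws-<max L fm R (m≤n⇒m≤1+n p≤i) (<-trans 1+i<j j<q) (<⇒≢ 1+i<j)
  ... | tri> _ _ m<j  = draws-left<right L R (m≤n⇒m≤1+n p≤i) 1+i<m m<j j<q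
  last-ascent : ∀ m → p < m → m < q → (∀ {i} → p ≤ i → i < m → f i < f m) → suc m ≡ q → ⊥
  last-ascent (suc i) (s≤s p≤i) 1+i<q <max refl =
    av p≤i 1+i<q (<max p≤i (n<1+n i))
      λ 1+i<j j<2+i → contradiction (<-≤-trans 1+i<j (s≤s⁻¹ j<2+i)) (<-irrefl refl)
  condition : ∀ {l r u} → Draws f l p m v u → Draws f r (suc m) q u w → C₁ l r
  condition leaf           _              = tt
  condition (node _ _ _)   (node _ _ _)   = tt
  condition (node L′ _ R′) leaf           =
    last-ascent m (≤-<-trans (draws-p≤q L′) (draws-p≤q R′)) m<q
      (λ p≤i i<m → draws-<max L fm R p≤i (<-trans i<m m<q) (<⇒≢ i<m)) refl

-- No descent leads into the maximum, and one by one out of it would need the second largest value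
-- at the start of the right part.
draws-avoids₂ : Draws f t p q v w → Hereditarily C₂ t → Avoids₂ f p q
draws-avoids₂ leaf _ {i} p≤i 1+i<p _ =
  contradiction (<-trans (s≤s p≤i) 1+i<p) (<-irrefl refl)
draws-avoids₂ {f} {q = q} (node {m = m} L fm R) (c , hl , hr) {i} p≤i 1+i<q fi≡1+f1+i
  with <-cmp (suc i) m
... | tri< 1+i<m _ _  = draws-avoids₂ L hl p≤i 1+i<m fi≡1+f1+i
... | tri≈ _ refl _   = <-asym (≤-reflexive (sym fi≡1+f1+i))
  (draws-<max L fm R p≤i (<-trans (n<1+n i) 1+i<q) (<⇒≢ (n<1+n i)))
... | tri> _ _ (s≤s m≤i) with m≤n⇒m<n∨m≡n m≤i
...   | inj₁ m<i  = draws-avoids₂ R hr m<i 1+i<q fi≡1+f1+i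
...   | inj₂ refl = below c R (trans (sym fm) fi≡1+f1+i)
  where
  below : ∀ {r u w} → NotMaxFirst r → Draws f r (suc m) q u w → w ≢ suc (f (suc m))
  below _ leaf _ = contradiction 1+i<q (<-irrefl refl)
  -- The right part begins inside the nonempty left subtree of its root, hence below its own
  -- maximum.
  below _ (node L′@(node L″ _ R″) fm′ R′) refl = <-irrefl refl
    (<-≤-trans (draws-< L′ ≤-refl (≤-<-trans (draws-p≤q L″) (draws-p≤q R″))) (draws-v≤w R′))

avoids₂-good : Draws f t p q v w → Avoids₂ f p q → Hereditarily C₂ t
avoids₂-good leaf _ = tt
avoids₂-good {f} {q = q} (node {w = w} {m = m} L fm R) av =
  condition R fm ,
  avoids₂-good L (λ p≤i 1+i<m → av p≤i (<-trans 1+i<m (draws-p≤q R))) ,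
  avoids₂-good R (λ m<i → av (≤-trans (draws-p≤q L) (<⇒≤ m<i)))
  where
  condition : ∀ {r u w} → Draws f r (suc m) q u w → f m ≡ w → NotMaxFirst r
  condition leaf                  _  = tt
  condition (node (node _ _ _) _ _) _  = tt
  -- Here the right part starts with its maximum, one less than the value at `m`.
  condition (node leaf fm′ R′)    fm =
    av (draws-p≤q L) (draws-p≤q R′) (trans fm (cong suc (sym fm′)))

-- The value outside of [0 , n) is irrelevant, but the identity makes
-- natural extensions of mutually inverse functions mutually inverse.
natural : (Fin n → Fin n) → ℕ → ℕ
natural {n} F i with i <? n
... | yes i<n = toℕ (F (fromℕ< i<n))
... | no  _   = i

natural-toℕ : ∀ (F : Fin n → Fin n) x → natural F (toℕ x) ≡ toℕ (F x)
natural-toℕ {n} F x with toℕ x <? n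
... | yes x<n = cong (toℕ ∘ F) (fromℕ<-toℕ x x<n)
... | no  x≮n = contradiction (toℕ<n x) x≮n

natural-inverse : ∀ (F G : Fin n → Fin n) → (∀ x → F (G x) ≡ x) →
                  ∀ i → natural F (natural G i) ≡ i
natural-inverse {n} F G F∘G i with i <? n
... | yes i<n = trans (natural-toℕ F _) (trans (cong toℕ (F∘G _)) (toℕ-fromℕ< i<n))
... | no  i≮n with i <? n
...   | yes i<n = contradiction i<n i≮n
...   | no  _   = refl

index : ∀ {i} → i < n → ∃[ x ] toℕ {n} x ≡ i
index i<n = fromℕ< i<n , toℕ-fromℕ< i<n

natural-< : ∀ (F : Fin n → Fin n) {i} → i < n → natural F i < n
natural-< F i<n with index i<n
... | x , refl = subst (_< _) (sym (natural-toℕ F x)) (toℕ<n (F x))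

-- Occurrences in permutations and in functions on natural numbers

⟦_⟧ : Permutation′ n → ℕ → ℕ
⟦ π ⟧ = natural (π ⟨$⟩ʳ_)

⟨$⟩ʳ-injective : ∀ (π : Permutation′ n) → Injective _≡_ _≡_ (π ⟨$⟩ʳ_)
⟨$⟩ʳ-injective π eq = trans (sym (inverseˡ π)) (trans (cong (π ⟨$⟩ˡ_) eq) (inverseˡ π))

StrictlyIncreasing : ∀ {k} → (Fin k → Fin n) → Set
StrictlyIncreasing α = ∀ {x y} → x Fin.< y → α x Fin.< α y

strict⇒monotone : ∀ {k} {α : Fin k → Fin n} → StrictlyIncreasing α → Monotonic₁ Fin._≤_ Fin._≤_ α
strict⇒monotone inc {x} {y} x≤y with m≤n⇒m<n∨m≡n x≤y
... | inj₁ x<y = <⇒≤ (inc x<y)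
... | inj₂ x≡y with refl ← toℕ-injective x≡y = ≤-refl

strict⇒injective : ∀ {k} {α : Fin k → Fin n} → StrictlyIncreasing α → Injective _≡_ _≡_ α
strict⇒injective inc {x} {y} eq with <-cmp (toℕ x) (toℕ y)
... | tri< x<y _ _ = contradiction (cong toℕ eq) (<⇒≢ (inc x<y))
... | tri≈ _ x≡y _ = toℕ-injective x≡y
... | tri> _ _ y<x = contradiction (cong toℕ (sym eq)) (<⇒≢ (inc y<x))

monotone⇒strict : ∀ {k} {α : Fin k → Fin n} → Monotonic₁ Fin._≤_ Fin._≤_ α →
                  Injective _≡_ _≡_ α → StrictlyIncreasing α
monotone⇒strict mono inj x<y =
  ≤∧≢⇒< (mono (<⇒≤ x<y)) (λ eq → <⇒≢ x<y (cong toℕ (inj (toℕ-injective eq))))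

module OccurrenceProperties {k R} {τ : Permutation′ k} {π : Permutation′ n}
                            (o : Occurrence (mesh τ R) π) where
  open Occurrence o public

  α-strict : StrictlyIncreasing α
  α-strict = monotone⇒strict α-monotone α-injective

  β-strict : StrictlyIncreasing β
  β-strict = monotone⇒strict β-monotone β-injective

  π∘α≡β∘τ : ∀ x → π ⟨$⟩ʳ α x ≡ β (τ ⟨$⟩ʳ x)
  π∘α≡β∘τ x = ω⊆plot (x , τ ⟨$⟩ʳ x , refl , refl)

pair : Fin n → Fin n → Fin 2 → Fin n
pair x y = lookup (x ∷ y ∷ [])

pair-strict : ∀ {x y : Fin n} → x Fin.< y → StrictlyIncreasing (pair x y)
pair-strict x<y {0F} {1F} _ = x<y
pair-strict x<y {1F} {1F} (s≤s ())

triple : Fin n → Fin n → Fin n → Fin 3 → Fin n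
triple x y z = lookup (x ∷ y ∷ z ∷ [])

triple-strict : ∀ {x y z : Fin n} → x Fin.< y → y Fin.< z → StrictlyIncreasing (triple x y z)
triple-strict x<y y<z {0F} {1F} _ = x<y
triple-strict x<y y<z {0F} {2F} _ = <-trans x<y y<z
triple-strict x<y y<z {1F} {2F} _ = y<z
triple-strict x<y y<z {1F} {1F} (s≤s ())
triple-strict x<y y<z {2F} {1F} (s≤s ())
triple-strict x<y y<z {2F} {2F} (s≤s (s≤s ()))

module _ (π : Permutation′ n) where

  ⟦⟧-toℕ : ∀ x → ⟦ π ⟧ (toℕ x) ≡ toℕ (π ⟨$⟩ʳ x)
  ⟦⟧-toℕ = natural-toℕ (π ⟨$⟩ʳ_)

  occurrence231 : ∀ {x y z} → x Fin.< y → y Fin.< z → π ⟨$⟩ʳ z Fin.< π ⟨$⟩ʳ x →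
                  π ⟨$⟩ʳ x Fin.< π ⟨$⟩ʳ y → Occurrence (classical τ₂₃₁) π
  occurrence231 {x} {y} {z} x<y y<z πz<πx πx<πy = record
    { α           = triple x y z
    -- `β` lists the values in increasing order: the last entry is the smallest, the middle one the
    -- largest.
    ; β           = triple (π ⟨$⟩ʳ z) (π ⟨$⟩ʳ x) (π ⟨$⟩ʳ y)
    ; α-monotone  = strict⇒monotone (triple-strict x<y y<z)
    ; α-injective = strict⇒injective (triple-strict x<y y<z)
    ; β-monotone  = strict⇒monotone (triple-strict πz<πx πx<πy)
    ; β-injective = strict⇒injective (triple-strict πz<πx πx<πy)
    ; ω⊆plot      = λ where
        (0F , _ , refl , refl) → refl
        (1F , _ , refl , refl) → refl
        (2F , _ , refl , refl) → refl
    ; shadedEmpty = λ ()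
    }

  avoids⇒avoids231 : Avoids π (classical τ₂₃₁) → Avoids231 ⟦ π ⟧ 0 n
  avoids⇒avoids231 av _ i<j j<k k<n fk<fi fi<fj
    with index (<-trans (<-trans i<j j<k) k<n) | index (<-trans j<k k<n) | index k<n
  ... | x , refl | y , refl | z , refl =
    av (occurrence231 i<j j<k (subst₂ _<_ (⟦⟧-toℕ z) (⟦⟧-toℕ x) fk<fi)
                              (subst₂ _<_ (⟦⟧-toℕ x) (⟦⟧-toℕ y) fi<fj))

  avoids231⇒avoids : Avoids231 ⟦ π ⟧ 0 n → Avoids π (classical τ₂₃₁)
  avoids231⇒avoids av o =
    av z≤n (α-strict {0F} {1F} (n<1+n 0)) (α-strict {1F} {2F} (n<1+n 1)) (toℕ<n (α 2F))
       (subst₂ _<_ (value 2F) (value 0F) (β-strict {0F} {1F} (n<1+n 0)))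
       (subst₂ _<_ (value 0F) (value 1F) (β-strict {1F} {2F} (n<1+n 1)))
    where
    open OccurrenceProperties o
    value : ∀ x → toℕ (β (τ₂₃₁ ⟨$⟩ʳ x)) ≡ ⟦ π ⟧ (toℕ (α x))
    value x = sym (trans (⟦⟧-toℕ (α x)) (cong toℕ (π∘α≡β∘τ x)))

  -- The middle column has no positions, and a point in one of the two boxes right of `y` would lie
  -- below `π ⟨$⟩ʳ y`.
  occurrence₁ : ∀ {x y} → toℕ y ≡ suc (toℕ x) → π ⟨$⟩ʳ x Fin.< π ⟨$⟩ʳ y →
                (∀ {z} → y Fin.< z → π ⟨$⟩ʳ y Fin.< π ⟨$⟩ʳ z) → Occurrence m₁ π
  occurrence₁ {x} {y} y≡1+x πx<πy min = record
    { α           = pair x y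
    ; β           = pair (π ⟨$⟩ʳ x) (π ⟨$⟩ʳ y)
    ; α-monotone  = strict⇒monotone (pair-strict x<y)
    ; α-injective = strict⇒injective (pair-strict x<y)
    ; β-monotone  = strict⇒monotone (pair-strict πx<πy)
    ; β-injective = strict⇒injective (pair-strict πx<πy)
    ; ω⊆plot      = λ where
        (0F , _ , refl , refl) → refl
        (1F , _ , refl , refl) → refl
    ; shadedEmpty = λ where
        (here refl)                                 _ ((gap , _) , _) → column₁ gap
        (there (here refl))                         _ ((gap , _) , _) → column₁ gap
        (there (there (here refl)))                 _ ((gap , _) , _) → column₁ gap
        (there (there (there (here refl))))         _ (((s≤s y<z , _) , (_ , s≤s πz<πx)) , refl) →
          <-asym πz<πx (<-trans πx<πy (min y<z))
        (there (there (there (there (here refl))))) _ (((s≤s y<z , _) , (_ , s≤s πz<πy)) , refl) →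
          <-asym πz<πy (min y<z)
    }
    where
    x<y : x Fin.< y
    x<y = ≤-reflexive (sym y≡1+x)
    column₁ : ∀ {z} → suc (toℕ x) < suc z × suc z < suc (toℕ y) → ⊥
    column₁ (s≤s x<z , s≤s z<y) = <⇒≱ z<y (subst (_≤ _) (sym y≡1+x) x<z)

  -- Every shaded box lies in the middle column or the middle row, and neither has room between
  -- consecutive numbers.
  occurrence₂ : ∀ {x y} → toℕ y ≡ suc (toℕ x) → toℕ (π ⟨$⟩ʳ x) ≡ suc (toℕ (π ⟨$⟩ʳ y)) →
                Occurrence m₂ π
  occurrence₂ {x} {y} y≡1+x πx≡1+πy = record
    { α           = pair x y
    ; β           = pair (π ⟨$⟩ʳ y) (π ⟨$⟩ʳ x)
    ; α-monotone  = strict⇒monotone (pair-strict x<y)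
    ; α-injective = strict⇒injective (pair-strict x<y)
    ; β-monotone  = strict⇒monotone (pair-strict πy<πx)
    ; β-injective = strict⇒injective (pair-strict πy<πx)
    ; ω⊆plot      = λ where
        (0F , _ , refl , refl) → refl
        (1F , _ , refl , refl) → refl
    ; shadedEmpty = λ where
        (here refl)                                 _ ((_ , gap) , _) → noGap πx≡1+πy gap
        (there (here refl))                         _ ((gap , _) , _) → noGap y≡1+x gap
        (there (there (here refl)))                 _ ((gap , _) , _) → noGap y≡1+x gap
        (there (there (there (here refl))))         _ ((gap , _) , _) → noGap y≡1+x gap
        (there (there (there (there (here refl))))) _ ((_ , gap) , _) → noGap πx≡1+πy gap
    }
    where
    x<y : x Fin.< y
    x<y = ≤-reflexive (sym y≡1+x)
    πy<πx : π ⟨$⟩ʳ y Fin.< π ⟨$⟩ʳ x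
    πy<πx = ≤-reflexive (sym πx≡1+πy)
    noGap : ∀ {i j z} → j ≡ suc i → suc i < suc z × suc z < suc j → ⊥
    noGap refl (s≤s i<z , s≤s z<1+i) = <⇒≱ z<1+i i<z

  avoids⇒avoids₁ : Avoids π m₁ → Avoids₁ ⟦ π ⟧ 0 n
  avoids⇒avoids₁ av {i} _ 1+i<n fi<f1+i min with index (<-trans (n<1+n i) 1+i<n) | index 1+i<n
  ... | x , refl | y , y≡1+x =
    av (occurrence₁ y≡1+x (subst₂ _<_ (⟦⟧-toℕ x) fy fi<f1+i)
      λ {z} y<z → subst₂ _<_ fy (⟦⟧-toℕ z) (min (subst (_< toℕ z) y≡1+x y<z) (toℕ<n z)))
    where
    fy : ⟦ π ⟧ (suc (toℕ x)) ≡ toℕ (π ⟨$⟩ʳ y)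
    fy = trans (cong ⟦ π ⟧ (sym y≡1+x)) (⟦⟧-toℕ y)

  avoids⇒avoids₂ : Avoids π m₂ → Avoids₂ ⟦ π ⟧ 0 n
  avoids⇒avoids₂ av {i} _ 1+i<n fi≡1+f1+i with index (<-trans (n<1+n i) 1+i<n) | index 1+i<n
  ... | x , refl | y , y≡1+x =
    av (occurrence₂ y≡1+x (trans (sym (⟦⟧-toℕ x)) (trans fi≡1+f1+i
      (cong suc (trans (cong ⟦ π ⟧ (sym y≡1+x)) (⟦⟧-toℕ y))))))

-- What shaded columns and rows of length-two patterns enforce

locate : ∀ (β : Fin 2 → Fin n) y → (∃[ r ] gap β r y) ⊎ (∃[ x ] y ≡ β x)
locate β y with <-cmp (toℕ y) (toℕ (β 0F)) | <-cmp (toℕ y) (toℕ (β 1F))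
... | tri< y<β₀ _ _ | _             = inj₁ (0F , z<s , s<s y<β₀)
... | tri≈ _ y≡β₀ _ | _             = inj₂ (0F , toℕ-injective y≡β₀)
... | tri> _ _ β₀<y | tri< y<β₁ _ _ = inj₁ (1F , s<s β₀<y , s<s y<β₁)
... | tri> _ _ β₀<y | tri≈ _ y≡β₁ _ = inj₂ (1F , toℕ-injective y≡β₁)
... | tri> _ _ β₀<y | tri> _ _ β₁<y = inj₁ (2F , s<s β₁<y , s<s (toℕ<n y))

-- Otherwise the successor of `α 0F` would lie in the middle gap without being one of the two values
-- of `α`.
adjacent : ∀ (α : Fin 2 → Fin n) → StrictlyIncreasing α →
           (∀ x → gap α 1F x → ∃[ b ] x ≡ α b) → toℕ (α 1F) ≡ suc (toℕ (α 0F))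
adjacent α inc fills with m≤n⇒m<n∨m≡n (inc {0F} {1F} (n<1+n 0))
... | inj₂ 1+α₀≡α₁ = sym 1+α₀≡α₁
... | inj₁ 1+α₀<α₁ with index (<-trans 1+α₀<α₁ (toℕ<n (α 1F)))
...   | x , x≡1+α₀ with fills x (s<s (≤-reflexive (sym x≡1+α₀)) ,
                                 s<s (subst (_< _) (sym x≡1+α₀) 1+α₀<α₁))
...     | 0F , refl = contradiction x≡1+α₀ (<⇒≢ (n<1+n _))
...     | 1F , refl = contradiction (sym x≡1+α₀) (<⇒≢ 1+α₀<α₁)

module LengthTwo {R} {τ : Permutation′ 2} {π : Permutation′ n} (o : Occurrence (mesh τ R) π) where
  open OccurrenceProperties o public

  value : ∀ x → toℕ (β (τ ⟨$⟩ʳ x)) ≡ ⟦ π ⟧ (toℕ (α x))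
  value x = sym (trans (⟦⟧-toℕ π (α x)) (cong toℕ (π∘α≡β∘τ x)))

  column-reflects : ∀ {x a} → π ⟨$⟩ʳ x ≡ β a → x ≡ α (τ ⟨$⟩ˡ a)
  column-reflects {x} {a} eq = ⟨$⟩ʳ-injective π
    (trans eq (trans (cong β (sym (inverseʳ τ))) (sym (π∘α≡β∘τ (τ ⟨$⟩ˡ a)))))

  -- The point of the plot over `x` avoids every shaded box of the column, so its height is a value
  -- of `β`; by injectivity it is then a point of the occurrence.
  column-empty : ∀ {c} → (∀ r → (c , r) ∈ R) → ∀ x → gap α c x → ∃[ b ] x ≡ α b
  column-empty shaded x gap with locate β (π ⟨$⟩ʳ x)
  ... | inj₁ (r , gap′) = contradiction ((gap , gap′) , refl) (shadedEmpty (shaded r) _)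
  ... | inj₂ (a , eq)   = τ ⟨$⟩ˡ a , column-reflects eq

  row-empty : ∀ {r} → (∀ c → (c , r) ∈ R) → ∀ y → gap β r y → ∃[ a ] y ≡ β a
  row-empty shaded y gap with locate α (π ⟨$⟩ˡ y)
  ... | inj₁ (c , gap′) = contradiction ((gap′ , gap) , inverseʳ π) (shadedEmpty (shaded c) _)
  ... | inj₂ (b , eq)   = τ ⟨$⟩ʳ b ,
    trans (sym (inverseʳ π)) (trans (cong (π ⟨$⟩ʳ_) eq) (π∘α≡β∘τ b))

-- The shaded middle column makes the two positions adjacent. Of the boxes to their right only the
-- top one may contain points, so the second entry is a right-to-left minimum.
avoids₁⇒avoids : ∀ (π : Permutation′ n) → Avoids₁ ⟦ π ⟧ 0 n → Avoids π m₁
avoids₁⇒avoids {n} π av o = av z≤n (subst (_< n) α₁≡1+α₀ (toℕ<n (α 1F)))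
  (subst₂ _<_ (value 0F) f1+α₀ (β-strict {0F} {1F} (n<1+n 0)))
  min
  where
  open LengthTwo o
  α₁≡1+α₀ : toℕ (α 1F) ≡ suc (toℕ (α 0F))
  α₁≡1+α₀ = adjacent α α-strict (column-empty λ where
    0F → here refl
    1F → there (here refl)
    2F → there (there (here refl)))
  f1+α₀ : toℕ (β 1F) ≡ ⟦ π ⟧ (suc (toℕ (α 0F)))
  f1+α₀ = trans (value 1F) (cong ⟦ π ⟧ α₁≡1+α₀)
  minimal : ∀ z → α 1F Fin.< z → β 1F Fin.< π ⟨$⟩ʳ z
  minimal z α₁<z with locate β (π ⟨$⟩ʳ z)
  ... | inj₁ (0F , gap) = contradiction ((((s<s α₁<z) , s<s (toℕ<n z)) , gap) , refl)
                            (shadedEmpty (there (there (there (here refl)))) _)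
  ... | inj₁ (1F , gap) = contradiction ((((s<s α₁<z) , s<s (toℕ<n z)) , gap) , refl)
                            (shadedEmpty (there (there (there (there (here refl))))) _)
  ... | inj₁ (2F , s≤s β₁<πz , _) = β₁<πz
  ... | inj₂ (0F , eq) with refl ← column-reflects {a = 0F} eq =
    contradiction (α-strict {0F} {1F} (n<1+n 0)) (<-asym α₁<z)
  ... | inj₂ (1F , eq) with refl ← column-reflects {a = 1F} eq =
    contradiction α₁<z (<-irrefl refl)
  min : ∀ {j} → suc (toℕ (α 0F)) < j → j < n → ⟦ π ⟧ (suc (toℕ (α 0F))) < ⟦ π ⟧ j
  min 1+α₀<j j<n with index j<n
  ... | z , refl = subst₂ _<_ f1+α₀ (sym (⟦⟧-toℕ π z))
                     (minimal z (subst (_< toℕ z) (sym α₁≡1+α₀) 1+α₀<j))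

-- The middle column and the middle row are both fully shaded, which makes positions and values
-- consecutive.
avoids₂⇒avoids : ∀ (π : Permutation′ n) → Avoids₂ ⟦ π ⟧ 0 n → Avoids π m₂
avoids₂⇒avoids {n} π av o = av z≤n (subst (_< n) α₁≡1+α₀ (toℕ<n (α 1F)))
  (trans (sym (value 0F)) (trans β₁≡1+β₀ (cong suc (trans (value 1F) (cong ⟦ π ⟧ α₁≡1+α₀)))))
  where
  open LengthTwo o
  α₁≡1+α₀ : toℕ (α 1F) ≡ suc (toℕ (α 0F))
  α₁≡1+α₀ = adjacent α α-strict (column-empty λ where
    0F → there (here refl)
    1F → there (there (here refl))
    2F → there (there (there (here refl))))
  β₁≡1+β₀ : toℕ (β 1F) ≡ suc (toℕ (β 0F))
  β₁≡1+β₀ = adjacent β β-strict (row-empty λ where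
    0F → here refl
    1F → there (there (here refl))
    2F → there (there (there (there (here refl)))))

-- Counting

fromDrawing : ∀ {f t} → Draws f t 0 n 0 n → Permutation′ n
fromDrawing {n} {f} D = permutation F G F∘G G∘F
  where
  F G : Fin n → Fin n
  F x = fromℕ< (draws-< D z≤n (toℕ<n x))
  G y = fromℕ< (proj₁ (proj₂ (proj₂ (draws-surjective D (toℕ y) z≤n (toℕ<n y)))))
  f-G : ∀ y → f (toℕ (G y)) ≡ toℕ y
  f-G y = let i , _ , i<n , eq = draws-surjective D (toℕ y) z≤n (toℕ<n y)
          in trans (cong f (toℕ-fromℕ< i<n)) eq
  F∘G : ∀ y → F (G y) ≡ y
  F∘G y = toℕ-injective (trans (toℕ-fromℕ< _) (f-G y))
  G∘F : ∀ x → G (F x) ≡ x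
  G∘F x = toℕ-injective (draws-injective D z≤n (toℕ<n _) z≤n (toℕ<n x)
            (trans (f-G (F x)) (toℕ-fromℕ< _)))

Represents : Permutation′ n → Tree → Set
Represents {n} π t = Draws ⟦ π ⟧ t 0 n 0 n

fromDrawing-represents : ∀ {f t} (D : Draws f t 0 n 0 n) → Represents (fromDrawing D) t
fromDrawing-represents {n} {f} D = draws-cong agrees D
  where
  agrees : ∀ i → 0 ≤ i → i < n → f i ≡ ⟦ fromDrawing D ⟧ i
  agrees i _ i<n with index i<n
  ... | x , refl = sym (trans (⟦⟧-toℕ (fromDrawing D) x) (toℕ-fromℕ< _))

realise : ∀ t → size t ≡ n → ∃[ π ] Represents {n} π t
realise t refl = let _ , D = drawing t 0 0 in fromDrawing D , fromDrawing-represents D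

represents-unique : ∀ {π ρ : Permutation′ n} {t} → Represents π t → Represents ρ t →
                    ∀ x → π ⟨$⟩ʳ x ≡ ρ ⟨$⟩ʳ x
represents-unique {π = π} {ρ} D E x = toℕ-injective
  (trans (sym (⟦⟧-toℕ π x)) (trans (draws-unique D E (toℕ x) z≤n (toℕ<n x)) (⟦⟧-toℕ ρ x)))

represents-cong : ∀ {π ρ : Permutation′ n} {t} → (∀ x → π ⟨$⟩ʳ x ≡ ρ ⟨$⟩ʳ x) →
                  Represents π t → Represents ρ t
represents-cong {n} {π} {ρ} eq = draws-cong agrees
  where
  agrees : ∀ i → 0 ≤ i → i < n → ⟦ π ⟧ i ≡ ⟦ ρ ⟧ i
  agrees i _ i<n with index i<n
  ... | x , refl = trans (⟦⟧-toℕ π x) (trans (cong toℕ (eq x)) (sym (⟦⟧-toℕ ρ x)))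

represents-exists : ∀ (π : Permutation′ n) → Avoids π (classical τ₂₃₁) → ∃[ t ] Represents π t
represents-exists {n} π av = avoids231-draws
  (natural-inverse (π ⟨$⟩ˡ_) (π ⟨$⟩ʳ_) (λ _ → inverseˡ π))
  (natural-inverse (π ⟨$⟩ʳ_) (π ⟨$⟩ˡ_) (λ _ → inverseʳ π))
  n (≤-reflexive (sym (+-identityʳ n))) z≤n (sym (+-identityʳ n))
  (λ _ _ i<n → z≤n , natural-< (π ⟨$⟩ʳ_) i<n)
  (λ _ _ y<n → z≤n , natural-< (π ⟨$⟩ˡ_) y<n)
  (avoids⇒avoids231 π av)

bijection⇒∣∣≡ : ∀ {k} (A : Setoid _ _) (F : Fin k → Setoid.Carrier A) →
                (∀ {x y} → Setoid._≈_ A (F x) (F y) → x ≡ y) →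
                (∀ c → ∃[ x ] Setoid._≈_ A (F x) c) → ∣ A ∣≡ k
bijection⇒∣∣≡ A F inj sur = record
  { to        = proj₁ ∘ sur
  ; from      = F
  ; to-cong   = λ {c} {d} c≈d →
      inj (A.trans (proj₂ (sur c)) (A.trans c≈d (A.sym (proj₂ (sur d)))))
  ; from-cong = λ { refl → A.refl }
  ; inverse   = (λ {_} {c} c≈Fx → inj (A.trans (proj₂ (sur c)) c≈Fx)) ,
                (λ { {c} refl → proj₂ (sur c) })
  }
  where module A = Setoid A

-- Avoiders correspond to trees satisfying `C` everywhere, and these to codes. The resulting count
-- `a n` is the same for every such `C` and `m`, whence the equality for both patterns.
module Counting {C} (spec : MotzkinSpecification C) {m : MeshPattern}
  (good⇒avoids : ∀ {n} (π : Permutation′ n) {t} → Represents π t → Hereditarily C t → Avoids π m)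
  (avoids⇒good : ∀ {n} (π : Permutation′ n) {t} → Represents π t → Avoids π m → Hereditarily C t)
  where
  open Decoding spec

  ∣Av∣≡a : ∀ n → ∣ Av n (classical τ₂₃₁ ∷ m ∷ []) ∣≡ a n
  ∣Av∣≡a n = bijection⇒∣∣≡ (Av n _) avoider avoider-injective avoider-surjective
    where
    open Inverse (Fin↔Code n) using (to; from; strictlyInverseˡ)
    open Setoid (Av n (classical τ₂₃₁ ∷ m ∷ [])) using (Carrier; _≈_)

    realisation : ∀ x → ∃[ π ] Represents {n} π (tree n (to x))
    realisation x = realise (tree n (to x)) (size-tree n (to x))

    avoider : Fin (a n) → Carrier
    avoider x = let π , D = realisation x in
      π , avoids231⇒avoids π (draws-avoids231 D) ∷ good⇒avoids π D (tree-good n (to x)) ∷ []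

    avoider-injective : ∀ {x y} → avoider x ≈ avoider y → x ≡ y
    avoider-injective {x} {y} eq = Injection.injective (↔⇒↣ (Fin↔Code n))
      (tree-injective n (draws-tree-unique
        (represents-cong {π = proj₁ (realisation x)} {ρ = proj₁ (realisation y)} eq
          (proj₂ (realisation x)))
        (proj₂ (realisation y))))

    avoider-surjective : ∀ π → ∃[ x ] avoider x ≈ π
    avoider-surjective (π , av231 ∷ av ∷ []) =
      let t , D  = represents-exists π av231
          c , eq = tree-surjective n t (avoids⇒good π D av) (draws-positions D)
          x      = from c
      in x , represents-unique {π = proj₁ (realisation x)} {ρ = π}
           (proj₂ (realisation x))
           (subst (Represents π) (sym (trans (cong (tree n) (strictlyInverseˡ c)) eq)) D)

a≡motzkin : ∀ n → 1 ≤ n → a n ≡ motzkin (n ∸ 1)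
-- The summand `forests (suc n) 0` is 0, leaving the trees with `suc n` nodes.
a≡motzkin (suc n) _ = forests≡motzkinPaths n 0

mainTheorem10 : ∃[ a ]
    (∀ n → ∣ Av n (classical τ₂₃₁ ∷ m₁ ∷ []) ∣≡ a n)
    × (∀ n → ∣ Av n (classical τ₂₃₁ ∷ m₂ ∷ []) ∣≡ a n)
    × (let P = generatingFunction a in
    P ≗ (X ⊛ (P ⊛ P) ⊖ X ⊛ (P ⊖ 𝟙)) ⊕ 𝟙)
    × map a (upTo 8) ≡ 1 ∷ 1 ∷ 1 ∷ 2 ∷ 4 ∷ 9 ∷ 21 ∷ 51 ∷ []
    × map motzkin (upTo 4) ≡ 1 ∷ 1 ∷ 2 ∷ 4 ∷ []
    × (∀ n → 1 ≤ n → a n ≡ motzkin (n ∸ 1))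
mainTheorem10 =
  a ,
  Counting.∣Av∣≡a spec₁
    (λ π D good → avoids₁⇒avoids π (draws-avoids₁ D good))
    (λ π D av → avoids₁-good D (avoids⇒avoids₁ π av)) ,
  Counting.∣Av∣≡a spec₂
    (λ π D good → avoids₂⇒avoids π (draws-avoids₂ D good))
    (λ π D av → avoids₂-good D (avoids⇒avoids₂ π av)) ,
  a-functionalEquation , refl , refl , a≡motzkin
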